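{- Let $k\geq 1$, let $L=\{U_1,\ldots,U_k\}$ be the first-order language with $k$ unary predicate symbols, let $1\leq p\leq k$, let $\bar{s}=\langle i_1,\ldots,i_p\rangle$ with $1\leq i_1<\cdots<i_p\leq k$, let $e\in\{0,1\}^k$, and let $\phi_{\bar{s},e}(x)=U_{i_1}^{e(i_1)}(x)\wedge\cdots\wedge U_{i_p}^{e(i_p)}(x)$ be the corresponding basic property of $L$. (i) If $p=1$, then $d(\phi_{\bar{s},e}:\mathrm{typ})=1/2$. (ii) If $p\geq 2$, then $d(\phi_{\bar{s},e}:\mathrm{typ})=0$. (In each case the limit defining $d(\phi_{\bar s,e}:\mathrm{typ})$ exists and has the stated value.)
   Context: For a predicate symbol $U_i$ put $U_i^{1}(x)=U_i(x)$ and $U_i^{0}(x)=\neg U_i(x)$. For a language $L$ let $\mathbf{S}_n(L)$ be the set of $L$-structures with universe $\{1,\ldots,n\}$. For a formula $\phi(x)$ of $L$ with one free variable and without parameters (a "property"), and an $L$-structure $\mathcal{M}$ with universe $M$, let $\phi(\mathcal{M})=\{a\in M:\mathcal{M}\models\phi(a)\}$. The property $\phi(x)$ is typical for a finite structure $\mathcal{M}$ with $|M|=n$ if $|\phi(\mathcal{M})|>n/2$. Let $\mathbf{S}_n(\phi:\mathrm{typ})=\{\mathcal{M}\in\mathbf{S}_n(L):|\phi(\mathcal{M})|>n/2\}$, $d_n(\phi:\mathrm{typ})=|\mathbf{S}_n(\phi:\mathrm{typ})|/|\mathbf{S}_n(L)|$, and $d(\phi:\mathrm{typ})=\lim_{n\to\infty}d_n(\phi:\mathrm{typ})$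 whenever this limit exists. -}

module Defs where

open import Data.Bool using (Bool; true; false)
open import Data.Fin using (Fin)
import Data.Fin as Fin
import Data.Fin.Properties as Fin
open import Data.Fin.Subset using (Subset; inside; outside; ∣_∣; _∈_)
open import Data.Fin.Subset.Properties using (_∈?_)
import Data.Integer as ℤ
open import Data.List using (List; []; _∷_; length; filter; cartesianProductWith)
import Data.List.Membership.Propositional as List
open import Data.List.Membership.Propositional.Properties
  using (∈-cartesianProductWith⁺; ∈-length)
open import Data.List.Relation.Unary.All using ([]; _∷_)
open import Data.List.Relation.Unary.Any using (here; there)
open import Data.List.Relation.Unary.Unique.Propositional using (Unique; []; _∷_)
open import Data.List.Relation.Unary.Unique.Propositional.Properties
  using (cartesianProductWith⁺)
open import Data.Nat using (ℕ; zero; suc; _*_; _<_; _<?_; _≥_; NonZero; >-nonZero)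
open import Data.Product using (_×_; _,_; ∃-syntax)
open import Data.Rational as ℚ using (ℚ; 0ℚ)
open import Data.Sum using (_⊎_)
open import Data.Empty using (⊥)
open import Data.Vec using (Vec; []; _∷_; lookup; map; tabulate; replicate; foldr₁)
open import Data.Vec.Properties using (∷-injective)
open import Data.Vec.Relation.Unary.Linked using (Linked)
open import Relation.Binary.PropositionalEquality using (_≡_; refl)
open import Relation.Nullary using (Dec; does; no; ¬_; ¬?; _×-dec_; _⊎-dec_; _→-dec_)

-- First-order formulas with equality over k unary predicate symbols, with
-- free variables in Fin m.  Variables are de Bruijn indices: the quantifiers
-- bind index zero.

data Formula (k : ℕ) (m : ℕ) : Set where
  U         : Fin k → Fin m → Formula k m
  _≐_       : Fin m → Fin m → Formula k m
  ⊥′        : Formula k m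
  ¬′_       : Formula k m → Formula k m
  _∧′_ _∨′_ _⇒′_ : Formula k m → Formula k m → Formula k m
  ∀′_ ∃′_   : Formula k (suc m) → Formula k m

infix  8 _≐_
infix  7 ¬′_ ∀′_ ∃′_
infixr 6 _∧′_
infixr 5 _∨′_
infixr 4 _⇒′_

Property : ℕ → Set
Property k = Formula k 1

-- The universe {1, …, n} is represented by Fin n; a structure lists the
-- interpretations of the k predicate symbols.

Structure : ℕ → ℕ → Set
Structure k n = Vec (Subset n) k

infix 3 _⊨_[_] _⊨?_[_]

_⊨_[_] : ∀ {k n m} → Structure k n → Formula k m → Vec (Fin n) m → Set
M ⊨ U i x [ ρ ]  = lookup ρ x ∈ lookup M i
M ⊨ x ≐ y [ ρ ]  = lookup ρ x ≡ lookup ρ y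
M ⊨ ⊥′ [ ρ ]     = ⊥
M ⊨ ¬′ φ [ ρ ]   = ¬ (M ⊨ φ [ ρ ])
M ⊨ φ ∧′ ψ [ ρ ] = (M ⊨ φ [ ρ ]) × (M ⊨ ψ [ ρ ])
M ⊨ φ ∨′ ψ [ ρ ] = (M ⊨ φ [ ρ ]) ⊎ (M ⊨ ψ [ ρ ])
M ⊨ φ ⇒′ ψ [ ρ ] = (M ⊨ φ [ ρ ]) → (M ⊨ ψ [ ρ ])
M ⊨ ∀′ φ [ ρ ]   = ∀ a → M ⊨ φ [ a ∷ ρ ]
M ⊨ ∃′ φ [ ρ ]   = ∃[ a ] (M ⊨ φ [ a ∷ ρ ])

_⊨?_[_] : ∀ {k n m} (M : Structure k n) (φ : Formula k m) (ρ : Vec (Fin n) m) →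
          Dec (M ⊨ φ [ ρ ])
M ⊨? U i x [ ρ ]  = lookup ρ x ∈? lookup M i
M ⊨? x ≐ y [ ρ ]  = lookup ρ x Fin.≟ lookup ρ y
M ⊨? ⊥′ [ ρ ]     = no λ ()
M ⊨? ¬′ φ [ ρ ]   = ¬? (M ⊨? φ [ ρ ])
M ⊨? φ ∧′ ψ [ ρ ] = (M ⊨? φ [ ρ ]) ×-dec (M ⊨? ψ [ ρ ])
M ⊨? φ ∨′ ψ [ ρ ] = (M ⊨? φ [ ρ ]) ⊎-dec (M ⊨? ψ [ ρ ])
M ⊨? φ ⇒′ ψ [ ρ ] = (M ⊨? φ [ ρ ]) →-dec (M ⊨? ψ [ ρ ])
M ⊨? ∀′ φ [ ρ ]   = Fin.all? λ a → M ⊨? φ [ a ∷ ρ ]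
M ⊨? ∃′ φ [ ρ ]   = Fin.any? λ a → M ⊨? φ [ a ∷ ρ ]

-- The set φ(M).

extension : ∀ {k n} → Property k → Structure k n → Subset n
extension φ M = tabulate λ a → does (M ⊨? φ [ a ∷ [] ])

-- |φ(M)| > n / 2 with the denominator cleared.

Typical : ∀ {k n} → Property k → Structure k n → Set
Typical {n = n} φ M = n < 2 * ∣ extension φ M ∣

typical? : ∀ {k n} (φ : Property k) (M : Structure k n) → Dec (Typical φ M)
typical? {n = n} φ M = n <? 2 * ∣ extension φ M ∣

vectors : ∀ {A : Set} → List A → ∀ n → List (Vec A n)
vectors xs zero    = [] ∷ []
vectors xs (suc n) = cartesianProductWith _∷_ xs (vectors xs n)

subsets : ∀ n → List (Subset n)
subsets = vectors (outside ∷ inside ∷ [])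

-- The set S_n(L), as a list; it has every structure exactly once, by
-- structures-complete and structures-unique below.

structures : ∀ k n → List (Structure k n)
structures k n = vectors (subsets n) k

typicalStructures : ∀ {k} → Property k → ∀ n → List (Structure k n)
typicalStructures {k} φ n = filter (typical? φ) (structures k n)

vectors-complete : ∀ {A : Set} {xs : List A} → (∀ x → x List.∈ xs) →
                   ∀ {n} (v : Vec A n) → v List.∈ vectors xs n
vectors-complete all []      = here refl
vectors-complete all (x ∷ v) =
  ∈-cartesianProductWith⁺ _∷_ (all x) (vectors-complete all v)

vectors-unique : ∀ {A : Set} {xs : List A} → Unique xs → ∀ n → Unique (vectors xs n)
vectors-unique xs! zero    = [] ∷ []
vectors-unique xs! (suc n) =
  cartesianProductWith⁺ _∷_ ∷-injective xs! (vectors-unique xs! n)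

structures-complete : ∀ {k n} (M : Structure k n) → M List.∈ structures k n
structures-complete = vectors-complete (vectors-complete λ where
  false → here refl
  true  → there (here refl))

structures-unique : ∀ k n → Unique (structures k n)
structures-unique k n =
  vectors-unique (vectors-unique (((λ ()) ∷ []) ∷ [] ∷ []) n) k

structures-nonZero : ∀ k n → NonZero (length (structures k n))
structures-nonZero k n =
  >-nonZero (∈-length (structures-complete (replicate k (replicate n outside))))

d-typ : ∀ {k} → Property k → ℕ → ℚ
d-typ {k} φ n =
  (ℤ.+ length (typicalStructures φ n)) ℚ./ length (structures k n)
  where instance _ = structures-nonZero k n

-- Convergence of a rational sequence to a rational limit.  By density of ℚ
-- in ℝ, rational ε give the usual notion.

infix 4 _⟶_

_⟶_ : (ℕ → ℚ) → ℚ → Set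
a ⟶ l = ∀ ε → 0ℚ ℚ.< ε → ∃[ N ] (∀ n → n ≥ N → ℚ.∣ a n ℚ.- l ∣ ℚ.< ε)

-- The literals U_i¹(x) = U_i(x) and U_i⁰(x) = ¬ U_i(x), where e(i) = 1 is true.

literal : ∀ {k} → Fin k → Bool → Property k
literal i true  = U i Fin.zero
literal i false = ¬′ U i Fin.zero

StrictlyIncreasing : ∀ {k p} → Vec (Fin k) p → Set
StrictlyIncreasing = Linked Fin._<_

basicProperty : ∀ {k p} .{{_ : NonZero p}} → Vec (Fin k) p → Vec Bool k → Property k
basicProperty {p = suc _} s e = foldr₁ _∧′_ (map (λ i → literal i (lookup e i)) s)

{-# OPTIONS --safe #-}
-- A count over all structures that only looks at one or two predicates
-- reduces to a count over one or two subsets of the universe.  Complementing a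
-- subset permutes the list of all subsets, so the signs e play no role.
--
-- (i) By complement symmetry the subsets with more than n/2 elements are as
-- many as those with fewer, so the density misses 1/2 only by half the
-- proportion of the subsets with exactly n/2 elements, and
-- C(2m, m)² (2m + 1) ≤ 16^m.
--
-- (ii) A typical structure has |A ∩ B| > n/2 for the first two (possibly
-- complemented) predicates A, B.  As the sum of 4^|A ∩ B| over all pairs (A, B)
-- is 7^n, Markov's inequality bounds the density by (7/8)^n.
module Submission where

open import Defs
open import Data.Bool using (Bool; true; false; if_then_else_; not; _∧_)
open import Data.Fin using (Fin; zero; suc)
import Data.Fin as Fin
open import Data.Fin.Subset using (Subset; inside; outside; ∣_∣; _∩_; ∁)
open import Data.Fin.Subset.Properties
  using (_∈?_; ∣p∣≤n; ∣∁p∣≡n∸∣p∣; ∣p∩q∣≤∣p∣; ∩-assoc)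
open import Data.Integer as ℤ using (-[1+_]; +[1+_])
import Data.Integer.Properties as ℤ
import Data.Integer.Tactic.RingSolver as ℤ-Solver
open import Data.List using (List; []; _∷_; length; filter; map; _++_; cartesianProductWith)
open import Data.List.Properties using (map-cong; length-++; length-map; map-++; map-∘)
open import Data.Nat
  using (ℕ; zero; suc; _+_; _*_; _∸_; _^_; _!; _≤_; _<_; _≥_; _<?_; _≟_;
         z≤n; s≤s; NonZero; >-nonZero⁻¹)
open import Data.Nat.Combinatorics
  using (_C_; nCk+nC[k+1]≡[n+1]C[k+1]; nCk≡n!/k![n-k]!; k![n∸k]!∣n!)
open import Data.Nat.DivMod using (m/n*n≡m)
open import Data.Nat.ListAction using (sum)
open import Data.Nat.ListAction.Properties using (sum-++)
open import Data.Nat.Properties hiding (_≟_; _<?_)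
open import Data.Nat.Tactic.RingSolver using (solve-∀)
open import Data.Product using (_×_; _,_; ∃-syntax)
open import Data.Rational as ℚ using (mkℚ; 0ℚ; ½; *<*)
import Data.Rational.Properties as ℚ
open import Data.Rational.Unnormalised as ℚᵘ using (mkℚᵘ)
import Data.Rational.Unnormalised.Properties as ℚᵘ
open import Data.Sum using (_⊎_; inj₁; inj₂)
open import Data.Vec using (Vec; []; _∷_; lookup; tabulate)
open import Data.Vec.Properties
  using (tabulate-cong; tabulate∘lookup; tabulate-∘)
open import Data.Vec.Relation.Unary.Linked using (_∷_)
open import Function using (_∘_)
open import Relation.Binary.Definitions using (tri<; tri≈; tri>)
open import Relation.Binary.PropositionalEquality
open import Relation.Nullary using (Dec; does; yes; no; ¬_; contradiction)
open import Relation.Nullary.Decidable using (dec-true; dec-false)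
open import Relation.Unary using (Decidable)

private variable
  A B C′ : Set
  k n : ℕ

-- Powers and finite sums over lists.

^-distribʳ-* : ∀ n a b → (a * b) ^ n ≡ a ^ n * b ^ n
^-distribʳ-* zero    a b = refl
^-distribʳ-* (suc n) a b = trans (cong (a * b *_) (^-distribʳ-* n a b)) (interchange a b (a ^ n) (b ^ n))
  where
  interchange : ∀ a b c d → a * b * (c * d) ≡ a * c * (b * d)
  interchange = solve-∀

∑ : List A → (A → ℕ) → ℕ
∑ xs f = sum (map f xs)

∑-cong : ∀ (xs : List A) {f g : A → ℕ} → f ≗ g → ∑ xs f ≡ ∑ xs g
∑-cong xs f≗g = cong sum (map-cong f≗g xs)

∑-mono-≤ : ∀ (xs : List A) {f g : A → ℕ} → (∀ x → f x ≤ g x) → ∑ xs f ≤ ∑ xs g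
∑-mono-≤ []       f≤g = z≤n
∑-mono-≤ (x ∷ xs) f≤g = +-mono-≤ (f≤g x) (∑-mono-≤ xs f≤g)

∑-distrib-+ : ∀ (xs : List A) (f g : A → ℕ) → ∑ xs (λ x → f x + g x) ≡ ∑ xs f + ∑ xs g
∑-distrib-+ []       f g = refl
∑-distrib-+ (x ∷ xs) f g rewrite ∑-distrib-+ xs f g =
  interchange (f x) (g x) (∑ xs f) (∑ xs g)
  where
  interchange : ∀ a b c d → a + b + (c + d) ≡ a + c + (b + d)
  interchange = solve-∀

*-distribˡ-∑ : ∀ c (xs : List A) (f : A → ℕ) → c * ∑ xs f ≡ ∑ xs (λ x → c * f x)
*-distribˡ-∑ c []       f = *-zeroʳ c
*-distribˡ-∑ c (x ∷ xs) f =
  trans (*-distribˡ-+ c (f x) _) (cong (c * f x +_) (*-distribˡ-∑ c xs f))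

*-distribʳ-∑ : ∀ c (xs : List A) (f : A → ℕ) → ∑ xs f * c ≡ ∑ xs (λ x → f x * c)
*-distribʳ-∑ c xs f = trans (*-comm _ c)
  (trans (*-distribˡ-∑ c xs f) (∑-cong xs λ x → *-comm c (f x)))

∑-const : ∀ (xs : List A) c → ∑ xs (λ _ → c) ≡ length xs * c
∑-const []       c = refl
∑-const (x ∷ xs) c = cong (c +_) (∑-const xs c)

-- Sums over products and over vectors.

∑-cartesianProductWith : ∀ (g : A → B → C′) xs ys (f : C′ → ℕ) →
  ∑ (cartesianProductWith g xs ys) f ≡ ∑ xs λ x → ∑ ys λ y → f (g x y)
∑-cartesianProductWith g []       ys f = refl
∑-cartesianProductWith g (x ∷ xs) ys f = begin
  sum (map f (map (g x) ys ++ rest))                    ≡⟨ cong sum (map-++ f (map (g x) ys) rest) ⟩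
  sum (map f (map (g x) ys) ++ map f rest)              ≡⟨ sum-++ (map f (map (g x) ys)) _ ⟩
  sum (map f (map (g x) ys)) + ∑ rest f                 ≡⟨ cong₂ _+_ (cong sum (sym (map-∘ ys))) (∑-cartesianProductWith g xs ys f) ⟩
  ∑ ys (f ∘ g x) + ∑ xs (λ x′ → ∑ ys λ y → f (g x′ y))  ∎
  where
  open ≡-Reasoning
  rest = cartesianProductWith g xs ys

length-cartesianProductWith : ∀ (g : A → B → C′) xs ys →
  length (cartesianProductWith g xs ys) ≡ length xs * length ys
length-cartesianProductWith g []       ys = refl
length-cartesianProductWith g (x ∷ xs) ys =
  trans (length-++ (map (g x) ys))
        (cong₂ _+_ (length-map (g x) ys) (length-cartesianProductWith g xs ys))

length-vectors : ∀ (xs : List A) n → length (vectors xs n) ≡ length xs ^ n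
length-vectors xs zero    = refl
length-vectors xs (suc n) =
  trans (length-cartesianProductWith _∷_ xs (vectors xs n))
        (cong (length xs *_) (length-vectors xs n))

-- Each entry of `xs` occupies coordinate `i` in `length xs ^ (k - 1)` vectors. The extra factor
-- `length xs` on the left avoids the exponent `k - 1`.
∑-vectors-lookup : ∀ (xs : List A) (i : Fin k) (f : A → ℕ) →
  ∑ (vectors xs k) (λ v → f (lookup v i)) * length xs ≡ length (vectors xs k) * ∑ xs f
∑-vectors-lookup {k = suc k} xs zero f = begin
  ∑ (vectors xs (suc k)) (λ v → f (lookup v zero)) * ℓ
    ≡⟨ cong (_* ℓ) (∑-cartesianProductWith _∷_ xs vs _) ⟩
  ∑ xs (λ x → ∑ vs λ _ → f x) * ℓ   ≡⟨ cong (_* ℓ) (∑-cong xs λ x → ∑-const vs (f x)) ⟩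
  ∑ xs (λ x → length vs * f x) * ℓ  ≡⟨ cong (_* ℓ) (*-distribˡ-∑ (length vs) xs f) ⟨
  length vs * ∑ xs f * ℓ            ≡⟨ rotate (length vs) (∑ xs f) ℓ ⟩
  ℓ * length vs * ∑ xs f            ≡⟨ cong (_* ∑ xs f) (length-cartesianProductWith _∷_ xs vs) ⟨
  length (vectors xs (suc k)) * ∑ xs f ∎
  where
  open ≡-Reasoning
  vs = vectors xs k
  ℓ = length xs
  rotate : ∀ a b c → a * b * c ≡ c * a * b
  rotate = solve-∀
∑-vectors-lookup {k = suc k} xs (suc i) f = begin
  ∑ (vectors xs (suc k)) (λ v → f (lookup v (suc i))) * ℓ
    ≡⟨ cong (_* ℓ) (∑-cartesianProductWith _∷_ xs vs _) ⟩
  ∑ xs (λ _ → S) * ℓ        ≡⟨ cong (_* ℓ) (∑-const xs S) ⟩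
  ℓ * S * ℓ                 ≡⟨ *-assoc ℓ S ℓ ⟩
  ℓ * (S * ℓ)               ≡⟨ cong (ℓ *_) (∑-vectors-lookup xs i f) ⟩
  ℓ * (length vs * ∑ xs f)  ≡⟨ *-assoc ℓ (length vs) (∑ xs f) ⟨
  ℓ * length vs * ∑ xs f    ≡⟨ cong (_* ∑ xs f) (length-cartesianProductWith _∷_ xs vs) ⟨
  length (vectors xs (suc k)) * ∑ xs f ∎
  where
  open ≡-Reasoning
  vs = vectors xs k
  ℓ = length xs
  S = ∑ vs λ v → f (lookup v i)

-- Two different coordinates range independently. The order `i < j` lets the recursion strip leading
-- coordinates until `i` is the head; the one-coordinate lemma then handles `j`.
∑-vectors-lookup₂ : ∀ (xs : List A) {i j : Fin k} → i Fin.< j → (f : A → A → ℕ) →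
  ∑ (vectors xs k) (λ v → f (lookup v i) (lookup v j)) * (length xs * length xs) ≡
  length (vectors xs k) * ∑ xs λ x → ∑ xs (f x)
∑-vectors-lookup₂ {k = suc k} xs {zero} {suc j} _ f = begin
  ∑ (vectors xs (suc k)) (λ v → f (lookup v zero) (lookup v (suc j))) * (ℓ * ℓ)
    ≡⟨ cong (_* (ℓ * ℓ)) (∑-cartesianProductWith _∷_ xs vs _) ⟩
  ∑ xs g * (ℓ * ℓ)                         ≡⟨ *-assoc (∑ xs g) ℓ ℓ ⟨
  ∑ xs g * ℓ * ℓ                           ≡⟨ cong (_* ℓ) (*-distribʳ-∑ ℓ xs g) ⟩
  ∑ xs (λ x → g x * ℓ) * ℓ                 ≡⟨ cong (_* ℓ) (∑-cong xs λ x → ∑-vectors-lookup xs j (f x)) ⟩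
  ∑ xs (λ x → length vs * ∑ xs (f x)) * ℓ  ≡⟨ cong (_* ℓ) (*-distribˡ-∑ (length vs) xs _) ⟨
  length vs * T * ℓ                        ≡⟨ rotate (length vs) T ℓ ⟩
  ℓ * length vs * T                        ≡⟨ cong (_* T) (length-cartesianProductWith _∷_ xs vs) ⟨
  length (vectors xs (suc k)) * T          ∎
  where
  open ≡-Reasoning
  vs = vectors xs k
  ℓ = length xs
  T = ∑ xs λ x → ∑ xs (f x)
  g = λ x → ∑ vs λ v → f x (lookup v j)
  rotate : ∀ a b c → a * b * c ≡ c * a * b
  rotate = solve-∀
∑-vectors-lookup₂ {k = suc k} xs {suc i} {suc j} (s≤s i<j) f = begin
  ∑ (vectors xs (suc k)) (λ v → f (lookup v (suc i)) (lookup v (suc j))) * (ℓ * ℓ)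
    ≡⟨ cong (_* (ℓ * ℓ)) (∑-cartesianProductWith _∷_ xs vs _) ⟩
  ∑ xs (λ _ → S) * (ℓ * ℓ)         ≡⟨ cong (_* (ℓ * ℓ)) (∑-const xs S) ⟩
  ℓ * S * (ℓ * ℓ)                  ≡⟨ *-assoc ℓ S (ℓ * ℓ) ⟩
  ℓ * (S * (ℓ * ℓ))                ≡⟨ cong (ℓ *_) (∑-vectors-lookup₂ xs i<j f) ⟩
  ℓ * (length vs * T)              ≡⟨ *-assoc ℓ (length vs) T ⟨
  ℓ * length vs * T                ≡⟨ cong (_* T) (length-cartesianProductWith _∷_ xs vs) ⟨
  length (vectors xs (suc k)) * T  ∎
  where
  open ≡-Reasoning
  vs = vectors xs k
  ℓ = length xs
  T = ∑ xs λ x → ∑ xs (f x)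
  S = ∑ vs λ v → f (lookup v i) (lookup v j)

-- Indicators and counting by sums.

-- Reading only the Boolean `does` lets indicators of comparisons such as `suc m ≟ suc j` reduce by
-- computation.
𝟙 : Dec A → ℕ
𝟙 a? = if does a? then 1 else 0

𝟙-yes : ∀ (a? : Dec A) → A → 𝟙 a? ≡ 1
𝟙-yes a? a rewrite dec-true a? a = refl

𝟙-no : ∀ (a? : Dec A) → ¬ A → 𝟙 a? ≡ 0
𝟙-no a? ¬a rewrite dec-false a? ¬a = refl

𝟙-mono-≤ : ∀ (a? : Dec A) (b? : Dec B) → (A → B) → 𝟙 a? ≤ 𝟙 b?
𝟙-mono-≤ (no _)  b? f = z≤n
𝟙-mono-≤ (yes a) b? f = ≤-reflexive (sym (𝟙-yes b? (f a)))

𝟙*-≤ : ∀ (a? : Dec A) {m o} → (A → m ≤ o) → 𝟙 a? * m ≤ o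
𝟙*-≤ (no _)  m≤o = z≤n
𝟙*-≤ (yes a) m≤o = ≤-trans (≤-reflexive (*-identityˡ _)) (m≤o a)

length-filter≡∑ : ∀ {P : A → Set} (P? : Decidable P) xs →
  length (filter P? xs) ≡ ∑ xs (𝟙 ∘ P?)
length-filter≡∑ P? []       = refl
length-filter≡∑ P? (x ∷ xs) with does (P? x)
... | true  = cong suc (length-filter≡∑ P? xs)
... | false = length-filter≡∑ P? xs

-- Sums over subsets and complementation.

∑-subsets-suc : ∀ n (f : Subset (suc n) → ℕ) →
  ∑ (subsets (suc n)) f ≡ ∑ (subsets n) (f ∘ (outside ∷_)) + ∑ (subsets n) (f ∘ (inside ∷_))
∑-subsets-suc n f =
  trans (∑-cartesianProductWith _∷_ (outside ∷ inside ∷ []) (subsets n) f)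
        (cong (∑ (subsets n) (f ∘ (outside ∷_)) +_) (+-identityʳ _))

-- Complementing the head swaps the two halves of `subsets (suc n)`, and commutativity of addition
-- swaps them back.
∑-∁ : ∀ n (f : Subset n → ℕ) → ∑ (subsets n) (f ∘ ∁) ≡ ∑ (subsets n) f
∑-∁ zero    f = refl
∑-∁ (suc n) f = begin
  ∑ (subsets (suc n)) (f ∘ ∁)    ≡⟨ ∑-subsets-suc n (f ∘ ∁) ⟩
  ∑ (subsets n) (f ∘ (inside ∷_) ∘ ∁) + ∑ (subsets n) (f ∘ (outside ∷_) ∘ ∁)
    ≡⟨ cong₂ _+_ (∑-∁ n (f ∘ (inside ∷_))) (∑-∁ n (f ∘ (outside ∷_))) ⟩
  ∑ (subsets n) (f ∘ (inside ∷_)) + ∑ (subsets n) (f ∘ (outside ∷_))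
    ≡⟨ +-comm (∑ (subsets n) (f ∘ (inside ∷_))) _ ⟩
  ∑ (subsets n) (f ∘ (outside ∷_)) + ∑ (subsets n) (f ∘ (inside ∷_))
    ≡⟨ ∑-subsets-suc n f ⟨
  ∑ (subsets (suc n)) f          ∎
  where open ≡-Reasoning

signed : Bool → Subset n → Subset n
signed true  X = X
signed false X = ∁ X

∑-signed : ∀ b (f : Subset n → ℕ) → ∑ (subsets n) (f ∘ signed b) ≡ ∑ (subsets n) f
∑-signed true  f = refl
∑-signed false f = ∑-∁ _ f

-- Extensions of literals and conjunctions.

does-∈? : ∀ (X : Subset n) a → does (a ∈? X) ≡ lookup X a
does-∈? (true  ∷ X) zero    = refl
does-∈? (false ∷ X) zero    = refl
does-∈? (_     ∷ X) (suc a) = does-∈? X a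

extension-literal : ∀ (i : Fin k) b (M : Structure k n) →
  extension (literal i b) M ≡ signed b (lookup M i)
extension-literal i true  M =
  trans (tabulate-cong (does-∈? (lookup M i))) (tabulate∘lookup (lookup M i))
extension-literal i false M =
  trans (tabulate-∘ not _)
        (cong ∁ (trans (tabulate-cong (does-∈? (lookup M i))) (tabulate∘lookup (lookup M i))))

tabulate-∧ : ∀ (f g : Fin n → Bool) → tabulate (λ a → f a ∧ g a) ≡ tabulate f ∩ tabulate g
tabulate-∧ {zero}  f g = refl
tabulate-∧ {suc n} f g = cong (f zero ∧ g zero ∷_) (tabulate-∧ (f ∘ suc) (g ∘ suc))

extension-∧ : ∀ (φ ψ : Property k) (M : Structure k n) →
  extension (φ ∧′ ψ) M ≡ extension φ M ∩ extension ψ M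
extension-∧ φ ψ M = tabulate-∧ _ _

-- Further conjuncts can only shrink the extension. The split on `s` follows `foldr₁`, which ends in
-- a bare literal: with two literals the bound is an equality, otherwise the conjunction of the rest
-- is dropped after reassociating.
extension-basicProperty : ∀ {p} i j (s : Vec (Fin k) p) (e : Vec Bool k) (M : Structure k n) →
  ∣ extension (basicProperty (i ∷ j ∷ s) e) M ∣ ≤
  ∣ signed (lookup e i) (lookup M i) ∩ signed (lookup e j) (lookup M j) ∣
extension-basicProperty i j [] e M
  rewrite extension-∧ (literal i (lookup e i)) (literal j (lookup e j)) M
        | extension-literal i (lookup e i) M
        | extension-literal j (lookup e j) M = ≤-refl
extension-basicProperty i j s@(_ ∷ _) e M
  rewrite extension-∧ (literal i (lookup e i)) (basicProperty (j ∷ s) e) M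
        | extension-∧ (literal j (lookup e j)) (basicProperty s e) M
        | extension-literal i (lookup e i) M
        | extension-literal j (lookup e j) M
        | sym (∩-assoc (signed (lookup e i) (lookup M i))
                       (signed (lookup e j) (lookup M j))
                       (extension (basicProperty s e) M)) =
  ∣p∩q∣≤∣p∣ (signed (lookup e i) (lookup M i) ∩ signed (lookup e j) (lookup M j)) _

-- Binomial counts and the central binomial coefficient.

-- Splitting on whether the first element belongs to the subset gives Pascal's rule.
∑-∣∣≟ : ∀ n j → ∑ (subsets n) (λ X → 𝟙 (∣ X ∣ ≟ j)) ≡ n C j
∑-∣∣≟ zero    zero    = refl
∑-∣∣≟ zero    (suc j) = refl
∑-∣∣≟ (suc n) zero    = begin
  ∑ (subsets (suc n)) (λ X → 𝟙 (∣ X ∣ ≟ 0))  ≡⟨ ∑-subsets-suc n _ ⟩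
  ∑ (subsets n) (λ X → 𝟙 (∣ X ∣ ≟ 0)) + ∑ (subsets n) (λ _ → 0)
    ≡⟨ cong₂ _+_ (∑-∣∣≟ n 0) (trans (∑-const (subsets n) 0) (*-zeroʳ (length (subsets n)))) ⟩
  n C 0 + 0                                  ≡⟨⟩
  suc n C 0                                  ∎
  where open ≡-Reasoning
∑-∣∣≟ (suc n) (suc j) = begin
  ∑ (subsets (suc n)) (λ X → 𝟙 (∣ X ∣ ≟ suc j))  ≡⟨ ∑-subsets-suc n _ ⟩
  ∑ (subsets n) (λ X → 𝟙 (∣ X ∣ ≟ suc j)) + ∑ (subsets n) (λ X → 𝟙 (∣ X ∣ ≟ j))
    ≡⟨ cong₂ _+_ (∑-∣∣≟ n (suc j)) (∑-∣∣≟ n j) ⟩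
  n C suc j + n C j                              ≡⟨ +-comm (n C suc j) (n C j) ⟩
  n C j + n C suc j                              ≡⟨ nCk+nC[k+1]≡[n+1]C[k+1] n j ⟩
  suc n C suc j                                  ∎
  where open ≡-Reasoning

[2m]Cm*m!m!≡[2m]! : ∀ m → (2 * m C m) * (m ! * m !) ≡ (2 * m) !
[2m]Cm*m!m!≡[2m]! m = begin
  (2 * m C m) * (m ! * m !)              ≡⟨ cong (λ r → (2 * m C m) * (m ! * r !)) 2m∸m≡m ⟨
  (2 * m C m) * (m ! * (2 * m ∸ m) !)    ≡⟨ cong (_* (m ! * (2 * m ∸ m) !)) (nCk≡n!/k![n-k]! m≤2m) ⟩
  _                                      ≡⟨ m/n*n≡m (k![n∸k]!∣n! m≤2m) ⟩
  (2 * m) !                              ∎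
  where
  open ≡-Reasoning
  instance _ = m !* (2 * m ∸ m) !≢0
  m≤2m : m ≤ 2 * m
  m≤2m = m≤m+n m (m + 0)
  2m∸m≡m : 2 * m ∸ m ≡ m
  2m∸m≡m = trans (m+n∸m≡n m (m + 0)) (+-identityʳ m)

-- Multiplied by `suc m * (m ! * m !)`, both sides become `(2 * suc m) !`.
centralC-suc : ∀ m → suc m * (2 * suc m C suc m) ≡ 2 * suc (2 * m) * (2 * m C m)
centralC-suc m = *-cancelʳ-≡ _ _ (suc m * (m ! * m !)) (begin
  suc m * b′ * (suc m * (m ! * m !))       ≡⟨ shuffle₁ (suc m) b′ (m !) ⟩
  b′ * (suc m * m ! * (suc m * m !))       ≡⟨ [2m]Cm*m!m!≡[2m]! (suc m) ⟩
  (2 * suc m) !                            ≡⟨ cong _! (*-suc 2 m) ⟩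
  (2 + 2 * m) * (suc (2 * m) * (2 * m) !)  ≡⟨ cong (λ f → (2 + 2 * m) * (suc (2 * m) * f)) ([2m]Cm*m!m!≡[2m]! m) ⟨
  (2 + 2 * m) * (suc (2 * m) * (b * (m ! * m !))) ≡⟨ shuffle₂ m b (m ! * m !) ⟩
  2 * suc (2 * m) * b * (suc m * (m ! * m !)) ∎)
  where
  open ≡-Reasoning
  b = 2 * m C m
  b′ = 2 * suc m C suc m
  instance
    _ = m !* m !≢0
    _ = m*n≢0 (suc m) (m ! * m !)
  shuffle₁ : ∀ s c f → s * c * (s * (f * f)) ≡ c * (s * f * (s * f))
  shuffle₁ = solve-∀
  shuffle₂ : ∀ m c q → (2 + 2 * m) * (suc (2 * m) * (c * q)) ≡ 2 * suc (2 * m) * c * (suc m * q)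
  shuffle₂ = solve-∀

-- Passing from m to m + 1 multiplies the left side by 4(2m + 1)(2m + 3) / (m + 1)², which is below
-- 16 since (2m + 1)(2m + 3) < (2m + 2)².
centralC-bound : ∀ m → (2 * m C m) * (2 * m C m) * suc (2 * m) ≤ 16 ^ m
centralC-bound zero    = ≤-refl
centralC-bound (suc m) = *-cancelʳ-≤ _ _ (suc m * suc m) (begin
  b′ * b′ * suc (2 * suc m) * (suc m * suc m)      ≡⟨ shuffle₁ m b′ ⟩
  suc m * b′ * (suc m * b′) * (3 + 2 * m)          ≡⟨ cong (λ c → c * c * (3 + 2 * m)) (centralC-suc m) ⟩
  2 * suc (2 * m) * b * (2 * suc (2 * m) * b) * (3 + 2 * m) ≡⟨ shuffle₂ m b ⟩
  b * b * suc (2 * m) * (4 * suc (2 * m) * (3 + 2 * m)) ≤⟨ *-monoˡ-≤ (4 * suc (2 * m) * (3 + 2 * m)) (centralC-bound m) ⟩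
  -- The added 4 completes the square: 4(2m + 1)(2m + 3) + 4 = 16(m + 1)².
  16 ^ m * (4 * suc (2 * m) * (3 + 2 * m))         ≤⟨ *-monoʳ-≤ (16 ^ m) (m≤m+n _ 4) ⟩
  16 ^ m * (4 * suc (2 * m) * (3 + 2 * m) + 4)     ≡⟨ shuffle₃ m (16 ^ m) ⟩
  16 * 16 ^ m * (suc m * suc m)                    ∎)
  where
  open ≤-Reasoning
  b = 2 * m C m
  b′ = 2 * suc m C suc m
  shuffle₁ : ∀ m c → c * c * suc (2 * suc m) * (suc m * suc m) ≡ suc m * c * (suc m * c) * (3 + 2 * m)
  shuffle₁ = solve-∀
  shuffle₂ : ∀ m c → 2 * suc (2 * m) * c * (2 * suc (2 * m) * c) * (3 + 2 * m) ≡
                     c * c * suc (2 * m) * (4 * suc (2 * m) * (3 + 2 * m))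
  shuffle₂ = solve-∀
  shuffle₃ : ∀ m c → c * (4 * suc (2 * m) * (3 + 2 * m) + 4) ≡ 16 * c * (suc m * suc m)
  shuffle₃ = solve-∀

-- Subsets with more than, or exactly, half of the elements.

majorities ties : ℕ → ℕ
majorities n = ∑ (subsets n) λ X → 𝟙 (n <? 2 * ∣ X ∣)
ties n       = ∑ (subsets n) λ X → 𝟙 (2 * ∣ X ∣ ≟ n)

ties-even : ∀ m → ties (2 * m) ≡ 2 * m C m
ties-even m = trans (∑-cong (subsets (2 * m)) pointwise) (∑-∣∣≟ (2 * m) m)
  where
  pointwise : ∀ X → 𝟙 (2 * ∣ X ∣ ≟ 2 * m) ≡ 𝟙 (∣ X ∣ ≟ m)
  pointwise X = ≤-antisym (𝟙-mono-≤ (2 * ∣ X ∣ ≟ 2 * m) (∣ X ∣ ≟ m) (*-cancelˡ-≡ _ _ 2))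
                          (𝟙-mono-≤ (∣ X ∣ ≟ m) (2 * ∣ X ∣ ≟ 2 * m) (cong (2 *_)))

ties-odd : ∀ m → ties (suc (2 * m)) ≡ 0
ties-odd m =
  trans (∑-cong Xs λ X → 𝟙-no (2 * ∣ X ∣ ≟ suc (2 * m)) (even≢odd ∣ X ∣ m))
        (trans (∑-const Xs 0) (*-zeroʳ (length Xs)))
  where Xs = subsets (suc (2 * m))

even⊎odd : ∀ n → ∃[ m ] (n ≡ 2 * m ⊎ n ≡ suc (2 * m))
even⊎odd zero = 0 , inj₁ refl
even⊎odd (suc n) with even⊎odd n
... | m , inj₁ refl = m , inj₂ refl
... | m , inj₂ refl = suc m , inj₁ (sym (*-suc 2 m))

-- The square-root-free form of `ties n / 2 ^ n` ≤ 1/√(n + 1). Odd n admits no tie, and for n = 2m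
-- the count is the central binomial coefficient, with 4^n = 16^m.
ties-bound : ∀ n → ties n * ties n * suc n ≤ 4 ^ n
ties-bound n with even⊎odd n
... | m , inj₁ refl rewrite ties-even m | sym (^-*-assoc 4 2 m) = centralC-bound m
... | m , inj₂ refl rewrite ties-odd m = z≤n

length-subsets : ∀ n → length (subsets n) ≡ 2 ^ n
length-subsets n = length-vectors _ n

-- Complementation turns one copy of `majorities n` into the number of subsets whose complement is a
-- majority. Every subset is then a majority, the complement of one, or a tie, and exactly one of
-- these.
2majorities+ties : ∀ n → 2 * majorities n + ties n ≡ 2 ^ n
2majorities+ties n = begin
  2 * majorities n + ties n ≡⟨ cong (λ r → majorities n + r + ties n) (+-identityʳ (majorities n)) ⟩
  majorities n + majorities n + ties n
    ≡⟨ cong (λ r → majorities n + r + ties n) (∑-∁ n (λ X → 𝟙 (n <? 2 * ∣ X ∣))) ⟨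
  majorities n + ∑ (subsets n) (λ X → 𝟙 (n <? 2 * ∣ ∁ X ∣)) + ties n
    ≡⟨ cong (_+ ties n) (∑-distrib-+ (subsets n) _ _) ⟨
  ∑ (subsets n) (λ X → 𝟙 (n <? 2 * ∣ X ∣) + 𝟙 (n <? 2 * ∣ ∁ X ∣)) + ties n
    ≡⟨ ∑-distrib-+ (subsets n) _ _ ⟨
  ∑ (subsets n) (λ X → 𝟙 (n <? 2 * ∣ X ∣) + 𝟙 (n <? 2 * ∣ ∁ X ∣) + 𝟙 (2 * ∣ X ∣ ≟ n))
    ≡⟨ ∑-cong (subsets n) exactlyOne ⟩
  ∑ (subsets n) (λ _ → 1)   ≡⟨ ∑-const (subsets n) 1 ⟩
  length (subsets n) * 1    ≡⟨ *-identityʳ _ ⟩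
  length (subsets n)        ≡⟨ length-subsets n ⟩
  2 ^ n                     ∎
  where
  open ≡-Reasoning
  2∣X∣+2∣∁X∣≡2n : ∀ (X : Subset n) → 2 * ∣ X ∣ + 2 * ∣ ∁ X ∣ ≡ n + n
  2∣X∣+2∣∁X∣≡2n X = begin
    2 * ∣ X ∣ + 2 * ∣ ∁ X ∣  ≡⟨ *-distribˡ-+ 2 ∣ X ∣ ∣ ∁ X ∣ ⟨
    2 * (∣ X ∣ + ∣ ∁ X ∣)    ≡⟨ cong (λ r → 2 * (∣ X ∣ + r)) (∣∁p∣≡n∸∣p∣ X) ⟩
    2 * (∣ X ∣ + (n ∸ ∣ X ∣)) ≡⟨ cong (2 *_) (m+[n∸m]≡n (∣p∣≤n X)) ⟩
    2 * n                    ≡⟨ cong (n +_) (+-identityʳ n) ⟩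
    n + n                    ∎
  trichotomy : ∀ {x y} → x + y ≡ n + n → 𝟙 (n <? x) + 𝟙 (n <? y) + 𝟙 (x ≟ n) ≡ 1
  trichotomy {x} {y} x+y≡2n with <-cmp x n
  ... | tri< x<n x≢n x≯n
        rewrite 𝟙-no (n <? x) x≯n | 𝟙-no (x ≟ n) x≢n
              | 𝟙-yes (n <? y) (≰⇒> λ y≤n → <⇒≢ (+-mono-<-≤ x<n y≤n) x+y≡2n) = refl
  ... | tri≈ x≮n x≡n x≯n
        rewrite 𝟙-no (n <? x) x≯n | 𝟙-yes (x ≟ n) x≡n
              | 𝟙-no (n <? y) (λ n<y → <⇒≢ (+-mono-≤-< (≮⇒≥ x≮n) n<y) (sym x+y≡2n)) = refl
  ... | tri> _ x≢n n<x
        rewrite 𝟙-yes (n <? x) n<x | 𝟙-no (x ≟ n) x≢n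
              | 𝟙-no (n <? y) (λ n<y → <⇒≢ (+-mono-< n<x n<y) (sym x+y≡2n)) = refl
  exactlyOne : ∀ (X : Subset n) →
    𝟙 (n <? 2 * ∣ X ∣) + 𝟙 (n <? 2 * ∣ ∁ X ∣) + 𝟙 (2 * ∣ X ∣ ≟ n) ≡ 1
  exactlyOne X = trichotomy {2 * ∣ X ∣} {2 * ∣ ∁ X ∣} (2∣X∣+2∣∁X∣≡2n X)

-- Pairs of subsets weighted by their intersection.

-- The sum factors over the elements: of the four membership patterns in (X, Y), three have weight 1
-- and the common one has weight 4, giving 7 per element.
∑-4^∣∩∣ : ∀ n → ∑ (subsets n) (λ X → ∑ (subsets n) λ Y → 4 ^ ∣ X ∩ Y ∣) ≡ 7 ^ n
∑-4^∣∩∣ zero    = refl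
∑-4^∣∩∣ (suc n) = begin
  ∑ (subsets (suc n)) (λ X → ∑ (subsets (suc n)) λ Y → 4 ^ ∣ X ∩ Y ∣)
    ≡⟨ ∑-subsets-suc n _ ⟩
  ∑ (subsets n) (λ X → ∑ (subsets (suc n)) λ Y → 4 ^ ∣ (outside ∷ X) ∩ Y ∣) +
  ∑ (subsets n) (λ X → ∑ (subsets (suc n)) λ Y → 4 ^ ∣ (inside ∷ X) ∩ Y ∣)
    ≡⟨ cong₂ _+_ (∑-cong (subsets n) λ X → ∑-subsets-suc n _)
                 (∑-cong (subsets n) λ X → ∑-subsets-suc n _) ⟩
  ∑ (subsets n) (λ X → S X + S X) +
  ∑ (subsets n) (λ X → S X + ∑ (subsets n) λ Y → 4 * 4 ^ ∣ X ∩ Y ∣)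
    ≡⟨ cong (∑ (subsets n) (λ X → S X + S X) +_)
          (∑-cong (subsets n) λ X → cong (S X +_) (*-distribˡ-∑ 4 (subsets n) _)) ⟨
  ∑ (subsets n) (λ X → S X + S X) + ∑ (subsets n) (λ X → S X + 4 * S X)
    ≡⟨ ∑-distrib-+ (subsets n) _ _ ⟨
  ∑ (subsets n) (λ X → S X + S X + (S X + 4 * S X))
    ≡⟨ ∑-cong (subsets n) (λ X → collect (S X)) ⟩
  ∑ (subsets n) (λ X → 7 * S X)
    ≡⟨ *-distribˡ-∑ 7 (subsets n) S ⟨
  7 * ∑ (subsets n) S
    ≡⟨ cong (7 *_) (∑-4^∣∩∣ n) ⟩
  7 ^ suc n ∎
  where
  open ≡-Reasoning
  S : Subset n → ℕ
  S X = ∑ (subsets n) λ Y → 4 ^ ∣ X ∩ Y ∣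
  collect : ∀ s → s + s + (s + 4 * s) ≡ 7 * s
  collect = solve-∀

-- Distances between rationals reduced to natural-number inequalities.

-- With ε = a / b, it is enough to beat 1 / b.
∣T/N-l∣<ε : ∀ T N .{{_ : NonZero N}} l ε → 0ℚ ℚ.< ε →
  ℤ.∣ (ℤ.+ T) ℤ.* ℚ.↧ l ℤ.+ (ℤ.- ℚ.↥ l) ℤ.* (ℤ.+ N) ∣ * ℚ.↧ₙ ε < N * ℚ.↧ₙ l →
  ℚ.∣ (ℤ.+ T) ℚ./ N ℚ.- l ∣ ℚ.< ε
∣T/N-l∣<ε T N@(suc N-1) l@record{} ε@(mkℚ (ℤ.+ zero) b-1 _) (*<* 0<0) _ =
  contradiction (subst (ℤ.0ℤ ℤ.<_) (ℤ.*-zeroˡ (ℤ.+ 1)) 0<0) (ℤ.<-irrefl refl)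
∣T/N-l∣<ε T N@(suc N-1) l@record{} ε@(mkℚ (-[1+ _ ]) b-1 _) (*<* ()) _
∣T/N-l∣<ε T N@(suc N-1) l@record{} ε@(mkℚ +[1+ a ] b-1 _) _ bound = ℚ.toℚᵘ-cancel-< (begin-strict
  ℚ.toℚᵘ ℚ.∣ x ℚ.- l ∣                  ≃⟨ ℚ.toℚᵘ-homo-∣-∣ (x ℚ.- l) ⟩
  ℚᵘ.∣ ℚ.toℚᵘ (x ℚ.- l) ∣               ≃⟨ ℚᵘ.∣-∣-cong (ℚ.toℚᵘ-homo-+ x (ℚ.- l)) ⟩
  ℚᵘ.∣ ℚ.toℚᵘ x ℚᵘ.+ ℚ.toℚᵘ (ℚ.- l) ∣   ≃⟨ ℚᵘ.∣-∣-cong (ℚᵘ.+-cong (ℚ.toℚᵘ-fromℚᵘ (mkℚᵘ (ℤ.+ T) N-1)) (ℚ.toℚᵘ-homo‿- l)) ⟩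
  -- Among unnormalised rationals no common factor is cancelled: the absolute difference has
  -- numerator `e` and denominator `d`, and cross-multiplication finishes.
  ℚᵘ.∣ mkℚᵘ (ℤ.+ T) N-1 ℚᵘ.- ℚ.toℚᵘ l ∣ <⟨ ℚᵘ.*<* (subst₂ ℤ._<_ (ℤ.pos-* e b) (ℤ.pos-* (suc a) d) (ℤ.+<+ eb<[1+a]d)) ⟩
  ℚ.toℚᵘ ε                              ∎)
  where
  open ℚᵘ.≤-Reasoning
  x = (ℤ.+ T) ℚ./ N
  e = ℤ.∣ (ℤ.+ T) ℤ.* ℚ.↧ l ℤ.+ (ℤ.- ℚ.↥ l) ℤ.* (ℤ.+ N) ∣
  b = suc b-1
  d = N * ℚ.↧ₙ l
  eb<[1+a]d : e * b < suc a * d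
  eb<[1+a]d = <-≤-trans bound (m≤m+n d (a * d))

-- Since 2T = N - D, the distance from T / N to 1/2 is D / (2N).
∣T/N-½∣<ε : ∀ T D N .{{_ : NonZero N}} ε → 0ℚ ℚ.< ε →
  2 * T + D ≡ N → D * ℚ.↧ₙ ε < N * 2 → ℚ.∣ (ℤ.+ T) ℚ./ N ℚ.- ½ ∣ ℚ.< ε
∣T/N-½∣<ε T D N ε 0<ε 2T+D≡N bound =
  ∣T/N-l∣<ε T N ½ ε 0<ε (subst (λ e → e * ℚ.↧ₙ ε < N * 2) (sym ∣2T-N∣≡D) bound)
  where
  open ≡-Reasoning
  cancel : ∀ t d → t ℤ.* (ℤ.+ 2) ℤ.+ ℤ.-1ℤ ℤ.* ((ℤ.+ 2) ℤ.* t ℤ.+ d) ≡ ℤ.- d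
  cancel = ℤ-Solver.solve-∀
  ∣2T-N∣≡D : ℤ.∣ (ℤ.+ T) ℤ.* (ℤ.+ 2) ℤ.+ ℤ.-1ℤ ℤ.* (ℤ.+ N) ∣ ≡ D
  -- The integers 2 and `-1ℤ` are the denominator and the negated numerator of `½`.
  ∣2T-N∣≡D = begin
    ℤ.∣ (ℤ.+ T) ℤ.* (ℤ.+ 2) ℤ.+ ℤ.-1ℤ ℤ.* (ℤ.+ N) ∣
      ≡⟨ cong (λ i → ℤ.∣ (ℤ.+ T) ℤ.* (ℤ.+ 2) ℤ.+ ℤ.-1ℤ ℤ.* i ∣)
              (trans (cong ℤ.+_ (sym 2T+D≡N)) (cong (ℤ._+ (ℤ.+ D)) (ℤ.pos-* 2 T))) ⟩
    ℤ.∣ (ℤ.+ T) ℤ.* (ℤ.+ 2) ℤ.+ ℤ.-1ℤ ℤ.* ((ℤ.+ 2) ℤ.* (ℤ.+ T) ℤ.+ (ℤ.+ D)) ∣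
      ≡⟨ cong ℤ.∣_∣ (cancel (ℤ.+ T) (ℤ.+ D)) ⟩
    ℤ.∣ ℤ.- (ℤ.+ D) ∣  ≡⟨ ℤ.∣-i∣≡∣i∣ (ℤ.+ D) ⟩
    D                  ∎

∣T/N-0∣<ε : ∀ T N .{{_ : NonZero N}} ε → 0ℚ ℚ.< ε →
  T * ℚ.↧ₙ ε < N → ℚ.∣ (ℤ.+ T) ℚ./ N ℚ.- 0ℚ ∣ ℚ.< ε
∣T/N-0∣<ε T N ε 0<ε bound = ∣T/N-l∣<ε T N 0ℚ ε 0<ε
  (subst₂ (λ e m → e * ℚ.↧ₙ ε < m) (sym (cong ℤ.∣_∣ T*1+0≡T)) (sym (*-identityʳ N)) bound)
  where
  T*1+0≡T : (ℤ.+ T) ℤ.* ℤ.1ℤ ℤ.+ ℤ.0ℤ ℤ.* (ℤ.+ N) ≡ ℤ.+ T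
  T*1+0≡T = trans (ℤ.+-identityʳ _) (ℤ.*-identityʳ (ℤ.+ T))

-- Density of a single literal.

-- Typicality is decided by the `i`-th predicate alone and `∑-signed` absorbs its sign, so the
-- density is `majorities n / 2 ^ n`.
length-typicalStructures-literal : ∀ (i : Fin k) b n →
  length (typicalStructures (literal i b) n) * 2 ^ n ≡ length (structures k n) * majorities n
length-typicalStructures-literal {k} i b n = begin
  length (typicalStructures φ n) * 2 ^ n  ≡⟨ cong₂ _*_ (length-filter≡∑ (typical? φ) (structures k n)) (sym (length-subsets n)) ⟩
  ∑ (structures k n) (λ M → 𝟙 (typical? φ M)) * length (subsets n)
    ≡⟨ cong (_* length (subsets n)) (∑-cong (structures k n) λ M →
         cong (λ X → 𝟙 (n <? 2 * ∣ X ∣)) (extension-literal i b M)) ⟩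
  ∑ (structures k n) (λ M → f (signed b (lookup M i))) * length (subsets n)
    ≡⟨ ∑-vectors-lookup (subsets n) i (f ∘ signed b) ⟩
  length (structures k n) * ∑ (subsets n) (f ∘ signed b)
    ≡⟨ cong (length (structures k n) *_) (∑-signed b f) ⟩
  length (structures k n) * majorities n  ∎
  where
  open ≡-Reasoning
  φ = literal i b
  f : Subset n → ℕ
  f X = 𝟙 (n <? 2 * ∣ X ∣)

-- After squaring, `ties-bound` gives `ties n * K ≤ 2 ^ n`; the factor 2 supplies strictness.
ties-small : ∀ {K n} → K * K ≤ suc n → ties n * K < 2 ^ n * 2
ties-small {K} {n} K²≤1+n = ≤-<-trans tK≤2ⁿ (m<m*n (2 ^ n) 2 (s≤s (s≤s z≤n)))
  where
  instance _ = m^n≢0 2 n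
  square : ∀ a b → a * b * (a * b) ≡ a * a * (b * b)
  square = solve-∀
  open ≤-Reasoning
  [tK]²≤[2ⁿ]² : ties n * K * (ties n * K) ≤ 2 ^ n * 2 ^ n
  [tK]²≤[2ⁿ]² = begin
    ties n * K * (ties n * K)   ≡⟨ square (ties n) K ⟩
    ties n * ties n * (K * K)   ≤⟨ *-monoʳ-≤ (ties n * ties n) K²≤1+n ⟩
    ties n * ties n * suc n     ≤⟨ ties-bound n ⟩
    4 ^ n                       ≡⟨ ^-distribʳ-* n 2 2 ⟩
    2 ^ n * 2 ^ n               ∎
  tK≤2ⁿ : ties n * K ≤ 2 ^ n
  -- Strict monotonicity of squaring extracts the square root by contradiction.
  tK≤2ⁿ = ≮⇒≥ λ 2ⁿ<tK → <⇒≱ (*-mono-< 2ⁿ<tK 2ⁿ<tK) [tK]²≤[2ⁿ]²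

d-typ-literal : ∀ (i : Fin k) b → d-typ (literal i b) ⟶ ½
-- The distance to 1/2 is at most 1 / (2√(n + 1)), which is less than 1 / K once n ≥ K².
d-typ-literal {k} i b ε 0<ε = K * K , close
  where
  K = ℚ.↧ₙ ε
  close : ∀ n → n ≥ K * K → ℚ.∣ d-typ (literal i b) n ℚ.- ½ ∣ ℚ.< ε
  close n n≥K² = ∣T/N-½∣<ε T D N ε 0<ε (m+[n∸m]≡n 2T≤N) (*-cancelʳ-< (2 ^ n) _ _ D*K<N*2)
    where
    instance
      _ = structures-nonZero k n
      _ = m^n≢0 2 n
    N = length (structures k n)
    T = length (typicalStructures (literal i b) n)
    -- The truncated subtraction is exact by `2T≤N`, so `D / N` is the proportion of ties.
    D = N ∸ 2 * T
    swap : ∀ a b c → a * (b * c) ≡ b * (a * c)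
    swap = solve-∀
    2T*2ⁿ≡N*2maj : 2 * T * 2 ^ n ≡ N * (2 * majorities n)
    2T*2ⁿ≡N*2maj = trans (*-assoc 2 T (2 ^ n))
      (trans (cong (2 *_) (length-typicalStructures-literal i b n)) (swap 2 N (majorities n)))
    2T≤N : 2 * T ≤ N
    2T≤N = *-cancelʳ-≤ _ _ (2 ^ n) (begin
      2 * T * 2 ^ n           ≡⟨ 2T*2ⁿ≡N*2maj ⟩
      N * (2 * majorities n)  ≤⟨ *-monoʳ-≤ N (m≤m+n _ (ties n)) ⟩
      N * (2 * majorities n + ties n) ≡⟨ cong (N *_) (2majorities+ties n) ⟩
      N * 2 ^ n               ∎)
      where open ≤-Reasoning
    D*2ⁿ≡N*ties : D * 2 ^ n ≡ N * ties n
    D*2ⁿ≡N*ties = begin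
      (N ∸ 2 * T) * 2 ^ n               ≡⟨ *-distribʳ-∸ (2 ^ n) N (2 * T) ⟩
      N * 2 ^ n ∸ 2 * T * 2 ^ n         ≡⟨ cong₂ _∸_ (cong (N *_) (2majorities+ties n)) (sym 2T*2ⁿ≡N*2maj) ⟨
      N * (2 * majorities n + ties n) ∸ N * (2 * majorities n) ≡⟨ *-distribˡ-∸ N _ (2 * majorities n) ⟨
      N * (2 * majorities n + ties n ∸ 2 * majorities n) ≡⟨ cong (N *_) (m+n∸m≡n (2 * majorities n) (ties n)) ⟩
      N * ties n                        ∎
      where open ≡-Reasoning
    exchange : ∀ a b c → a * b * c ≡ a * c * b
    exchange = solve-∀
    D*K<N*2 : D * K * 2 ^ n < N * 2 * 2 ^ n
    D*K<N*2 = begin-strict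
      D * K * 2 ^ n     ≡⟨ exchange D K (2 ^ n) ⟩
      D * 2 ^ n * K     ≡⟨ cong (_* K) D*2ⁿ≡N*ties ⟩
      N * ties n * K    ≡⟨ *-assoc N (ties n) K ⟩
      N * (ties n * K)  <⟨ *-monoʳ-< N (ties-small {K} (m≤n⇒m≤1+n n≥K²)) ⟩
      N * (2 ^ n * 2)   ≡⟨ *-assoc N (2 ^ n) 2 ⟨
      N * 2 ^ n * 2     ≡⟨ exchange N (2 ^ n) 2 ⟩
      N * 2 * 2 ^ n     ∎
      where open ≤-Reasoning

-- Density of a conjunction of at least two literals.

-- If n < 2x, then 2^n ≤ 2^(2x) = 4^x: the pointwise form of Markov's inequality. Base 4 has the
-- integer square root 2, so the threshold weight at n/2 stays integral.
markov-4^ : ∀ n x → 𝟙 (n <? 2 * x) * 2 ^ n ≤ 4 ^ x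
markov-4^ n x = 𝟙*-≤ (n <? 2 * x) λ n<2x →
  ≤-trans (^-monoʳ-≤ 2 (<⇒≤ n<2x)) (≤-reflexive (sym (^-*-assoc 2 2 x)))

module _ {p} (i j : Fin k) (s : Vec (Fin k) p) (e : Vec Bool k) where

  private
    φ = basicProperty (i ∷ j ∷ s) e

  -- In 8^n = 2^n * 4^n, the factor 2^n is the Markov threshold and 4^n is the number of pairs of
  -- subsets; 7^n is the total weight of the pairs.
  length-typicalStructures-basicProperty : i Fin.< j → ∀ n →
    length (typicalStructures φ n) * 8 ^ n ≤ length (structures k n) * 7 ^ n
  length-typicalStructures-basicProperty i<j n = begin
    length (typicalStructures φ n) * 8 ^ n
      ≡⟨ cong₂ _*_ (length-filter≡∑ (typical? φ) Ms) 8ⁿ≡2ⁿ*ℓ*ℓ ⟩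
    ∑ Ms (λ M → 𝟙 (typical? φ M)) * (2 ^ n * (ℓ * ℓ))
      ≡⟨ *-assoc (∑ Ms _) (2 ^ n) (ℓ * ℓ) ⟨
    ∑ Ms (λ M → 𝟙 (typical? φ M)) * 2 ^ n * (ℓ * ℓ)
      ≡⟨ cong (_* (ℓ * ℓ)) (*-distribʳ-∑ (2 ^ n) Ms _) ⟩
    ∑ Ms (λ M → 𝟙 (typical? φ M) * 2 ^ n) * (ℓ * ℓ)
      ≤⟨ *-monoˡ-≤ (ℓ * ℓ) (∑-mono-≤ Ms markov) ⟩
    ∑ Ms (λ M → f (lookup M i) (lookup M j)) * (ℓ * ℓ)
      ≡⟨ ∑-vectors-lookup₂ (subsets n) i<j f ⟩
    length Ms * ∑ (subsets n) (λ X → ∑ (subsets n) (f X))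
      ≡⟨ cong (length Ms *_) (∑-cong (subsets n) λ X →
           ∑-signed (lookup e j) (λ Y → 4 ^ ∣ signed (lookup e i) X ∩ Y ∣)) ⟩
    length Ms * ∑ (subsets n) (λ X → ∑ (subsets n) λ Y → 4 ^ ∣ signed (lookup e i) X ∩ Y ∣)
      ≡⟨ cong (length Ms *_) (∑-signed (lookup e i) (λ X → ∑ (subsets n) λ Y → 4 ^ ∣ X ∩ Y ∣)) ⟩
    length Ms * ∑ (subsets n) (λ X → ∑ (subsets n) λ Y → 4 ^ ∣ X ∩ Y ∣)
      ≡⟨ cong (length Ms *_) (∑-4^∣∩∣ n) ⟩
    length Ms * 7 ^ n ∎
    where
    open ≤-Reasoning
    Ms = structures k n
    ℓ = length (subsets n)
    f : Subset n → Subset n → ℕ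
    f X Y = 4 ^ ∣ signed (lookup e i) X ∩ signed (lookup e j) Y ∣
    8ⁿ≡2ⁿ*ℓ*ℓ : 8 ^ n ≡ 2 ^ n * (ℓ * ℓ)
    8ⁿ≡2ⁿ*ℓ*ℓ = trans (^-distribʳ-* n 2 4) (cong (2 ^ n *_)
      (trans (^-distribʳ-* n 2 2) (sym (cong₂ _*_ (length-subsets n) (length-subsets n)))))
    markov : ∀ M → 𝟙 (typical? φ M) * 2 ^ n ≤ f (lookup M i) (lookup M j)
    markov M = ≤-trans (markov-4^ n ∣ extension φ M ∣)
                       (^-monoʳ-≤ 4 (extension-basicProperty i j s e M))

-- Bernoulli's inequality (8/7)^n ≥ 1 + n/7 with denominators cleared, giving an explicit rate for
-- the decay of (7/8)^n.
bernoulli : ∀ n → 7 ^ n * (7 + n) ≤ 7 * 8 ^ n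
bernoulli zero    = ≤-refl
bernoulli (suc n) = begin
  -- The slack comes from 8(7 + n) - 7(8 + n) = n.
  7 * 7 ^ n * (7 + suc n)              ≤⟨ m≤m+n _ (7 ^ n * n) ⟩
  7 * 7 ^ n * (7 + suc n) + 7 ^ n * n  ≡⟨ regroup (7 ^ n) n ⟩
  8 * (7 ^ n * (7 + n))                ≤⟨ *-monoʳ-≤ 8 (bernoulli n) ⟩
  8 * (7 * 8 ^ n)                      ≡⟨ swap (8 ^ n) ⟩
  7 * 8 ^ suc n                        ∎
  where
  open ≤-Reasoning
  regroup : ∀ a n → 7 * a * (7 + suc n) + a * n ≡ 8 * (a * (7 + n))
  regroup = solve-∀
  swap : ∀ a → 8 * (7 * a) ≡ 7 * (8 * a)
  swap = solve-∀

d-typ-basicProperty : ∀ {p} (i j : Fin k) (s : Vec (Fin k) p) (e : Vec Bool k) → i Fin.< j →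
  d-typ (basicProperty (i ∷ j ∷ s) e) ⟶ 0ℚ
-- By `bernoulli` the density is at most 7 / (7 + n), hence at most 1 / (K + 1) once n ≥ 7K.
d-typ-basicProperty {k} i j s e i<j ε 0<ε = 7 * K , close
  where
  K = ℚ.↧ₙ ε
  φ = basicProperty (i ∷ j ∷ s) e
  close : ∀ n → n ≥ 7 * K → ℚ.∣ d-typ φ n ℚ.- 0ℚ ∣ ℚ.< ε
  close n n≥7K = ∣T/N-0∣<ε T N ε 0<ε (T*K<N T T*[1+K]≤N)
    where
    open ≤-Reasoning
    instance
      _ = structures-nonZero k n
      _ = m^n≢0 7 n
    N = length (structures k n)
    T = length (typicalStructures φ n)
    swap : ∀ t a → t * (7 * a) ≡ 7 * (t * a)
    swap = solve-∀
    T*[1+K]≤N : T * suc K ≤ N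
    T*[1+K]≤N = *-cancelˡ-≤ 7 (*-cancelʳ-≤ _ _ (7 ^ n) (begin
      7 * (T * suc K) * 7 ^ n    ≡⟨ shuffle T K (7 ^ n) ⟩
      T * (7 ^ n * (7 + 7 * K))  ≤⟨ *-monoʳ-≤ T (*-monoʳ-≤ (7 ^ n) (+-monoʳ-≤ 7 n≥7K)) ⟩
      T * (7 ^ n * (7 + n))      ≤⟨ *-monoʳ-≤ T (bernoulli n) ⟩
      T * (7 * 8 ^ n)            ≡⟨ swap T (8 ^ n) ⟩
      7 * (T * 8 ^ n)            ≤⟨ *-monoʳ-≤ 7 (length-typicalStructures-basicProperty i j s e i<j n) ⟩
      7 * (N * 7 ^ n)            ≡⟨ *-assoc 7 N (7 ^ n) ⟨
      7 * N * 7 ^ n              ∎))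
      where
      shuffle : ∀ t q a → 7 * (t * suc q) * a ≡ t * (a * (7 + 7 * q))
      shuffle = solve-∀
    T*K<N : ∀ t → t * suc K ≤ N → t * K < N
    -- Strictness comes from N > 0 when t = 0 and from K < K + 1 otherwise.
    T*K<N zero        _   = >-nonZero⁻¹ N
    T*K<N t@(suc _) t≤N = <-≤-trans (*-monoʳ-< t (n<1+n K)) t≤N

theorem4p2 : (k p : ℕ) .{{_ : NonZero k}} .{{_ : NonZero p}} → p ≤ k →
    (s : Vec (Fin k) p) → StrictlyIncreasing s → (e : Vec Bool k) →
    (p ≡ 1 → d-typ (basicProperty s e) ⟶ ½) ×
    (2 ≤ p → d-typ (basicProperty s e) ⟶ 0ℚ)
-- The length of `s` decides which implication is vacuous; with two or more entries, the first link
-- of the increasing sequence is `i < j`.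
theorem4p2 _ _ _ (i ∷ [])    _         e = (λ _ → d-typ-literal i (lookup e i)) , λ { (s≤s ()) }
theorem4p2 _ _ _ (i ∷ j ∷ s) (i<j ∷ _) e = (λ ()) , λ _ → d-typ-basicProperty i j s e i<j
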